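{- Let $n\ge0$. The class-size distribution polynomial for $\sim_2$ on $\{\mathtt a,\mathtt b\}^n$, that is $\sum_{X\in\{\mathtt a,\mathtt b\}^n/{\sim_2}}z^{\#X}$, is equal to $$\sum_{[w]_{\sim_2}\in\{\mathtt a,\mathtt b\}^n/{\sim_2}}z^{\,[q^{\binom{w}{\mathtt{ab}}}]\binom{n}{|w|_{\mathtt a}}_{\!q}},$$ where the exponent does not depend on the choice of representative $w$ of the class.
   Context: $|w|_{\mathtt a}$ is the number of letters $\mathtt a$ in $w$ and $\binom{w}{\mathtt{ab}}$ the number of occurrences of $\mathtt{ab}$ as a scattered subword of $w$. For $u,w\in\{\mathtt a,\mathtt b\}^n$, $u\sim_2w$ iff $|u|_{\mathtt a}=|w|_{\mathtt a}$ and $\binom{u}{\mathtt{ab}}=\binom{w}{\mathtt{ab}}$. The Gaussian binomial coefficient is the polynomial $\binom{c}{d}_q=\prod_{i=1}^d\frac{1-q^{c-d+i}}{1-q^i}$ for $0\le d\le c$; $[q^k]f$ is the coefficient of $q^k$ in $f$. The variable $z$ is an indeterminate. -}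

module Defs where

open import Data.Bool.Base using (if_then_else_)
open import Data.Fin.Base using (Fin; toℕ)
import Data.Fin.Properties as Fin
open import Data.Integer.Base as ℤ using (ℤ; 0ℤ; 1ℤ)
import Data.Integer.Properties as ℤ
open import Data.Integer.Solver using (module +-*-Solver)
open import Data.List.Base as List
  using (List; []; _∷_; length; filter; deduplicate; cartesianProduct;
         cartesianProductWith; allFin; applyUpTo; foldr)
import Data.List.Properties as List
open import Data.Nat.Base as ℕ using (ℕ; zero; suc; _∸_; NonZero)
open import Data.Nat.Divisibility using (_∣?_; _∣_; _∣0; ∣m∸n∣n⇒∣m; ∣m+n∣m⇒∣n; ∣-refl; ∣⇒≤)
import Data.Nat.Properties as ℕ
open import Data.Product.Base using (_×_; _,_)
open import Data.Vec.Base using (Vec; []; _∷_; count; lookup)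
import Data.Vec.Properties as Vec
open import Function.Base using (_∘_)
open import Relation.Binary.Definitions using (Decidable; DecidableEquality)
open import Relation.Binary.PropositionalEquality
open import Relation.Nullary.Decidable using (yes; no; does; dec-true; dec-false; _×-dec_)
open import Relation.Nullary.Negation using (¬_)

open import Algebra.Properties.Semiring.Sum ℤ.+-*-semiring
  using (sum-syntax; sum-cong-≗; sum-replicate-zero)

open +-*-Solver using (solve; _:+_; _:-_; _:*_; _:=_)

data Letter : Set where
  𝚊 𝚋 : Letter

infix 4 _≟ᴸ_ _≟ᵂ_ _∼₂_ _∼₂?_ _≈_

_≟ᴸ_ : DecidableEquality Letter
𝚊 ≟ᴸ 𝚊 = yes refl
𝚊 ≟ᴸ 𝚋 = no λ ()
𝚋 ≟ᴸ 𝚊 = no λ ()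
𝚋 ≟ᴸ 𝚋 = yes refl

Word : ℕ → Set
Word = Vec Letter

_≟ᵂ_ : ∀ {n} → DecidableEquality (Word n)
_≟ᵂ_ = Vec.≡-dec _≟ᴸ_

words : ∀ n → List (Word n)
words zero    = [] ∷ []
words (suc n) = cartesianProductWith _∷_ (𝚊 ∷ 𝚋 ∷ []) (words n)

∣_∣ₐ : ∀ {n} → Word n → ℕ
∣ w ∣ₐ = count (𝚊 ≟ᴸ_) w

ab-occurrences : ∀ {n} → Word n → List (Fin n × Fin n)
ab-occurrences {n} w =
  filter (λ (i , j) → i Fin.<? j ×-dec lookup w i ≟ᴸ 𝚊 ×-dec lookup w j ≟ᴸ 𝚋)
         (cartesianProduct (allFin n) (allFin n))

#ab : ∀ {n} → Word n → ℕ
#ab w = length (ab-occurrences w)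

_∼₂_ : ∀ {n} → Word n → Word n → Set
u ∼₂ w = ∣ u ∣ₐ ≡ ∣ w ∣ₐ × #ab u ≡ #ab w

_∼₂?_ : ∀ {n} → Decidable (_∼₂_ {n})
u ∼₂? w = ∣ u ∣ₐ ℕ.≟ ∣ w ∣ₐ ×-dec #ab u ℕ.≟ #ab w

class : ∀ {n} → Word n → List (Word n)
class {n} w = filter (w ∼₂?_) (words n)

-- `words n` lists every word exactly once and `class` preserves its order, so
-- equivalent words have literally equal classes: the quotient is the image of
-- `class`, with each class listed once, and #X is `length X`.
quotient : ∀ n → List (List (Word n))
quotient n = deduplicate (List.≡-dec _≟ᵂ_) (List.map class (words n))

-- ℤ[[x]], by coefficients.  A polynomial is identified with its coefficient
-- sequence, so that [x^k] f is f k.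
Series : Set
Series = ℕ → ℤ

_≈_ : Series → Series → Set
f ≈ g = ∀ k → f k ≡ g k

infixl 6 _⊕_ _⊖_
infixl 7 _⊛_

𝟘 : Series
𝟘 _ = 0ℤ

x^_ : ℕ → Series
(x^ m) k = if does (m ℕ.≟ k) then 1ℤ else 0ℤ

𝟙 : Series
𝟙 = x^ 0

_⊕_ _⊖_ _⊛_ : Series → Series → Series
(f ⊕ g) k = f k ℤ.+ g k
(f ⊖ g) k = f k ℤ.- g k
(f ⊛ g) k = ∑[ j < suc k ] (f (toℕ j) ℤ.* g (k ∸ toℕ j))

Σ[_]_ : {A : Set} → List A → (A → Series) → Series
Σ[ xs ] f = foldr (λ x s → f x ⊕ s) 𝟘 xs

Π : List Series → Series
Π = foldr _⊛_ 𝟙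

-- 1 / (1 - x^i) = Σ_{j ≥ 0} x^{ij} for i ≥ 1; see 1-x^i-inverse.
1/1-x^_ : ℕ → Series
(1/1-x^ i) k = if does (i ∣? k) then 1ℤ else 0ℤ

private
  δ : ℕ → ℕ → ℤ
  δ = x^_

  ∑0 : ∀ n (h : ℕ → ℤ) → ∑[ j < n ] (0ℤ ℤ.* h (toℕ j)) ≡ 0ℤ
  ∑0 n h = trans (sum-cong-≗ {n} (λ j → ℤ.*-zeroˡ (h (toℕ j)))) (sum-replicate-zero n)

  ∑δ-< : ∀ {m n} (h : ℕ → ℤ) → m ℕ.< n →
         ∑[ j < n ] (δ m (toℕ j) ℤ.* h (toℕ j)) ≡ h m
  ∑δ-< {zero}  {suc n} h _ =
    trans (cong₂ ℤ._+_ (ℤ.*-identityˡ (h 0)) (∑0 n (h ∘ suc))) (ℤ.+-identityʳ (h 0))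
  ∑δ-< {suc m} {suc n} h (ℕ.s≤s m<n) =
    trans (cong₂ ℤ._+_ (ℤ.*-zeroˡ (h 0)) (∑δ-< (h ∘ suc) m<n)) (ℤ.+-identityˡ _)

  ∑δ-≥ : ∀ {m n} (h : ℕ → ℤ) → n ℕ.≤ m →
         ∑[ j < n ] (δ m (toℕ j) ℤ.* h (toℕ j)) ≡ 0ℤ
  ∑δ-≥ h ℕ.z≤n       = refl
  ∑δ-≥ h (ℕ.s≤s n≤m) =
    cong₂ ℤ._+_ (ℤ.*-zeroˡ (h 0)) (∑δ-≥ (h ∘ suc) n≤m)

  ⊖-⊛ : ∀ f g h → (f ⊖ g) ⊛ h ≈ (f ⊛ h) ⊖ (g ⊛ h)
  ⊖-⊛ f g h k = go (suc k) f g (λ j → h (k ∸ j))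
    where
    go : ∀ n (f g h : ℕ → ℤ) →
         ∑[ j < n ] ((f (toℕ j) ℤ.- g (toℕ j)) ℤ.* h (toℕ j)) ≡
         ∑[ j < n ] (f (toℕ j) ℤ.* h (toℕ j)) ℤ.- ∑[ j < n ] (g (toℕ j) ℤ.* h (toℕ j))
    go zero    f g h = refl
    go (suc n) f g h = trans
      (cong (ℤ._+_ ((f 0 ℤ.- g 0) ℤ.* h 0)) (go n (f ∘ suc) (g ∘ suc) (h ∘ suc)))
      (solve 5 (λ a b c s t → (a :- b) :* c :+ (s :- t) := (a :* c :+ s) :- (b :* c :+ t))
             refl (f 0) (g 0) (h 0) _ _)

  geom-∣ : ∀ {i k} → i ∣ k → (1/1-x^ i) k ≡ 1ℤ
  geom-∣ {i} {k} i∣k = cong (if_then 1ℤ else 0ℤ) (dec-true (i ∣? k) i∣k)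

  geom-∤ : ∀ {i k} → ¬ i ∣ k → (1/1-x^ i) k ≡ 0ℤ
  geom-∤ {i} {k} i∤k = cong (if_then 1ℤ else 0ℤ) (dec-false (i ∣? k) i∤k)

  geom-step : ∀ {i k} → i ℕ.≤ k → (1/1-x^ i) k ≡ (1/1-x^ i) (k ∸ i)
  geom-step {i} {k} i≤k with i ∣? (k ∸ i)
  ... | yes p = geom-∣ (∣m∸n∣n⇒∣m i i≤k p ∣-refl)
  ... | no ¬p = geom-∤ λ i∣k →
    ¬p (∣m+n∣m⇒∣n (subst (i ∣_) (sym (ℕ.m+[n∸m]≡n i≤k)) i∣k) ∣-refl)

  value : ∀ i .{{_ : NonZero i}} k →
          (1/1-x^ i) k ℤ.- (x^ i ⊛ (1/1-x^ i)) k ≡ 𝟙 k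
  value i k with i ℕ.≤? k
  value i@(suc _) zero | yes ()
  value i (suc k) | yes i≤k = trans
    (cong₂ ℤ._-_ (geom-step i≤k)
                 (∑δ-< {i} (λ j → (1/1-x^ i) (suc k ∸ j)) (ℕ.s≤s i≤k)))
    (ℤ.+-inverseʳ ((1/1-x^ i) (suc k ∸ i)))
  value i zero    | no i≰k = cong₂ ℤ._-_ (geom-∣ (i ∣0))
    (∑δ-≥ {i} (λ j → (1/1-x^ i) (0 ∸ j)) (ℕ.≰⇒> i≰k))
  value i (suc k) | no i≰k = cong₂ ℤ._-_ (geom-∤ (λ i∣k → i≰k (∣⇒≤ i∣k)))
    (∑δ-≥ {i} (λ j → (1/1-x^ i) (suc k ∸ j)) (ℕ.≰⇒> i≰k))

1-x^i-inverse : ∀ i .{{_ : NonZero i}} → (𝟙 ⊖ x^ i) ⊛ (1/1-x^ i) ≈ 𝟙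
1-x^i-inverse i k = trans (⊖-⊛ 𝟙 (x^ i) (1/1-x^ i) k)
  (trans (cong (ℤ._- (x^ i ⊛ (1/1-x^ i)) k)
               (∑δ-< {0} {suc k} (λ j → (1/1-x^ i) (k ∸ j)) (ℕ.s≤s ℕ.z≤n)))
         (value i k))

-- For d ≤ c.  The product of fractions is evaluated in ℤ[[q]], where every
-- denominator is a unit.  As ℤ[q] embeds in ℤ[[q]], the coefficients are those
-- of the polynomial which this product equals.
gaussian : ℕ → ℕ → Series
gaussian c d =
  Π (applyUpTo (λ i → (𝟙 ⊖ x^ (c ∸ d ℕ.+ suc i)) ⊛ (1/1-x^ suc i)) d)

exponent : ∀ {n} → Word n → ℤ
exponent {n} w = gaussian n ∣ w ∣ₐ (#ab w)

sizePolynomial : ℕ → Series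
sizePolynomial n = Σ[ quotient n ] λ X → x^ length X

{-# OPTIONS --safe #-}
module Submission where

-- By the theorem that the Gaussian coefficient generates words by #ab, the
-- exponent attached to a class is its size.  Both sides of that identity satisfy
-- one q-Pascal rule: removing the first letter of a word of length n + 1 with
-- d + 1 letters 𝚊 gives a word with the same #ab if that letter is 𝚋, and with
-- n - d fewer occurrences of 𝚊𝚋 if it is 𝚊.

import Algebra.Construct.Pointwise as Pointwise
import Algebra.Solver.Ring.NaturalCoefficients.Default as SemiringSolver
import Data.Fin.Properties as Fin
import Data.Integer.Properties as ℤ
import Data.Nat.Properties as ℕ
open import Defs
open import Algebra.Bundles using (CommutativeSemiring)
open import Algebra.Structures.Biased using (isCommutativeSemiringˡ)
open import Data.Bool.Base using (true; false)
open import Data.Fin.Base as Fin using (Fin)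
open import Data.Integer.Base as ℤ using (0ℤ; ∣_∣; _≤_)
open import Data.Integer.Solver using (module +-*-Solver)
open import Data.List.Base
  using (List; []; _∷_; _++_; _∷ʳ_; length; map; filter; cartesianProduct; allFin; tabulate;
         applyUpTo)
open import Data.List.Membership.Propositional using (_∈_)
open import Data.List.Membership.Propositional.Properties
  using (∈-deduplicate⁻; ∈-filter⁻; ∈-map⁻)
open import Data.List.Properties
  using (length-++; filter-++; filter-≐; filter-none; map-tabulate; ++-identityʳ; applyUpTo-∷ʳ; ≡-dec)
open import Data.List.Relation.Unary.All using (universal)
open import Data.List.Relation.Unary.Any using (here; there)
open import Data.Nat.Base as ℕ using (ℕ; zero; suc; _+_; _∸_; s≤s; z≤n; s<s; s<s⁻¹)
open import Data.Product.Base using (_×_; _,_; map₁; map₂)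
open import Data.Vec.Base using ([]; _∷_; lookup)
open import Data.Vec.Properties using (count≤n)
open import Function.Base using (_∘_; id)
open import Level using (0ℓ)
open import Relation.Binary.PropositionalEquality
  using (_≡_; refl; sym; trans; cong; cong₂; subst; module ≡-Reasoning)
open import Relation.Nullary.Decidable using (yes; no; does; _×-dec_)
open import Relation.Nullary.Negation using (¬_)
open import Relation.Unary using (Pred; Decidable; _≐_)

-- The commutative semiring of power series.

tail : Series → Series
tail f k = f (suc k)

-- The coefficient of `f ⊛ g` at `suc k` unfolds to `f 0 ℤ.* g (suc k) ℤ.+ (tail f ⊛ g) k`, so
-- product laws go by induction on the index, with the left factor replaced by its tail.
⊛-cong : ∀ {f f′ g g′} → f ≈ f′ → g ≈ g′ → f ⊛ g ≈ f′ ⊛ g′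
⊛-cong p q zero    = cong (ℤ._+ 0ℤ) (cong₂ ℤ._*_ (p 0) (q 0))
⊛-cong p q (suc k) =
  cong₂ ℤ._+_ (cong₂ ℤ._*_ (p 0) (q (suc k))) (⊛-cong (p ∘ suc) q k)

⊛-zeroˡ : ∀ f → 𝟘 ⊛ f ≈ 𝟘
⊛-zeroˡ f zero    = refl
⊛-zeroˡ f (suc k) = trans (ℤ.+-identityˡ _) (⊛-zeroˡ f k)

⊛-distribʳ : ∀ f g h → (g ⊕ h) ⊛ f ≈ g ⊛ f ⊕ h ⊛ f
⊛-distribʳ f g h zero    =
  solve 3 (λ a b c → (b :+ c) :* a :+ con 0ℤ := b :* a :+ con 0ℤ :+ (c :* a :+ con 0ℤ)) refl
    (f 0) (g 0) (h 0)
  where open +-*-Solver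
⊛-distribʳ f g h (suc k) = trans
  (cong (ℤ._+_ ((g 0 ℤ.+ h 0) ℤ.* f (suc k))) (⊛-distribʳ f (tail g) (tail h) k))
  (solve 5 (λ a b c s t → (b :+ c) :* a :+ (s :+ t) := b :* a :+ s :+ (c :* a :+ t)) refl
    (f (suc k)) (g 0) (h 0) ((tail g ⊛ f) k) ((tail h ⊛ f) k))
  where open +-*-Solver

⊛-identityˡ : ∀ f → 𝟙 ⊛ f ≈ f
⊛-identityˡ f zero    = trans (ℤ.+-identityʳ _) (ℤ.*-identityˡ (f 0))
⊛-identityˡ f (suc k) =
  trans (cong₂ ℤ._+_ (ℤ.*-identityˡ (f (suc k))) (⊛-zeroˡ f k)) (ℤ.+-identityʳ _)

-- Splits off the last summand of the convolution where the definition splits off the first;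
-- commutativity needs both.
⊛-sucʳ : ∀ f g k → (f ⊛ g) (suc k) ≡ (f ⊛ tail g) k ℤ.+ f (suc k) ℤ.* g 0
⊛-sucʳ f g zero    =
  solve 2 (λ a b → a :+ (b :+ con 0ℤ) := a :+ con 0ℤ :+ b) refl (f 0 ℤ.* g 1) (f 1 ℤ.* g 0)
  where open +-*-Solver
⊛-sucʳ f g (suc k) =
  trans (cong (ℤ._+_ (f 0 ℤ.* g (suc (suc k)))) (⊛-sucʳ (tail f) g k))
        (sym (ℤ.+-assoc (f 0 ℤ.* g (suc (suc k))) _ _))

⊛-comm : ∀ f g → f ⊛ g ≈ g ⊛ f
⊛-comm f g zero    = cong (ℤ._+ 0ℤ) (ℤ.*-comm (f 0) (g 0))
⊛-comm f g (suc k) = begin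
  f 0 ℤ.* g (suc k) ℤ.+ (tail f ⊛ g) k ≡⟨ cong₂ ℤ._+_ (ℤ.*-comm (f 0) _) (⊛-comm (tail f) g k) ⟩
  g (suc k) ℤ.* f 0 ℤ.+ (g ⊛ tail f) k ≡⟨ ℤ.+-comm _ ((g ⊛ tail f) k) ⟩
  (g ⊛ tail f) k ℤ.+ g (suc k) ℤ.* f 0 ≡⟨ ⊛-sucʳ g f k ⟨
  (g ⊛ f) (suc k)                      ∎
  where open ≡-Reasoning

scale-⊛ : ∀ c f g k → ((λ j → c ℤ.* f j) ⊛ g) k ≡ c ℤ.* (f ⊛ g) k
scale-⊛ c f g zero    =
  solve 3 (λ c a b → (c :* a) :* b :+ con 0ℤ := c :* (a :* b :+ con 0ℤ)) refl c (f 0) (g 0)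
  where open +-*-Solver
scale-⊛ c f g (suc k) = trans
  (cong (ℤ._+_ (c ℤ.* f 0 ℤ.* g (suc k))) (scale-⊛ c (tail f) g k))
  (solve 4 (λ c a b s → (c :* a) :* b :+ c :* s := c :* (a :* b :+ s)) refl
    c (f 0) (g (suc k)) ((tail f ⊛ g) k))
  where open +-*-Solver

⊛-assoc : ∀ f g h → (f ⊛ g) ⊛ h ≈ f ⊛ (g ⊛ h)
⊛-assoc f g h zero    =
  solve 3 (λ a b c → (a :* b :+ con 0ℤ) :* c :+ con 0ℤ := a :* (b :* c :+ con 0ℤ) :+ con 0ℤ)
    refl (f 0) (g 0) (h 0)
  where open +-*-Solver
⊛-assoc f g h (suc k) = begin
  -- By computation, the tail of `f ⊛ g` is `f 0` times `tail g`, plus `tail f ⊛ g`.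
  (f ⊛ g) 0 ℤ.* h (suc k) ℤ.+ (((λ j → f 0 ℤ.* tail g j) ⊕ tail f ⊛ g) ⊛ h) k
    ≡⟨ cong (ℤ._+_ ((f ⊛ g) 0 ℤ.* h (suc k))) (⊛-distribʳ h (λ j → f 0 ℤ.* tail g j) (tail f ⊛ g) k) ⟩
  (f ⊛ g) 0 ℤ.* h (suc k) ℤ.+ (((λ j → f 0 ℤ.* tail g j) ⊛ h) k ℤ.+ ((tail f ⊛ g) ⊛ h) k)
    ≡⟨ cong (ℤ._+_ ((f ⊛ g) 0 ℤ.* h (suc k)))
         (cong₂ ℤ._+_ (scale-⊛ (f 0) (tail g) h k) (⊛-assoc (tail f) g h k)) ⟩
  (f ⊛ g) 0 ℤ.* h (suc k) ℤ.+ (f 0 ℤ.* (tail g ⊛ h) k ℤ.+ (tail f ⊛ (g ⊛ h)) k)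
    ≡⟨ solve 5 (λ a b c s t → (a :* b :+ con 0ℤ) :* c :+ (a :* s :+ t) := a :* (b :* c :+ s) :+ t)
         refl (f 0) (g 0) (h (suc k)) ((tail g ⊛ h) k) ((tail f ⊛ (g ⊛ h)) k) ⟩
  (f ⊛ (g ⊛ h)) (suc k) ∎
  where
  open ≡-Reasoning
  open +-*-Solver

seriesSemiring : CommutativeSemiring 0ℓ 0ℓ
seriesSemiring = record
  { Carrier = Series
  ; _≈_ = _≈_
  ; _+_ = _⊕_
  ; _*_ = _⊛_
  ; 0# = 𝟘
  ; 1# = 𝟙
  ; isCommutativeSemiring = isCommutativeSemiringˡ record
    { +-isCommutativeMonoid = +.isCommutativeMonoid
    ; *-isCommutativeMonoid = record
      { isMonoid = record
        { isSemigroup = record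
          { isMagma = record
            { isEquivalence = +.isEquivalence
            ; ∙-cong = ⊛-cong
            }
          ; assoc = ⊛-assoc
          }
        ; identity = ⊛-identityˡ , λ f k → trans (⊛-comm f 𝟙 k) (⊛-identityˡ f k)
        }
      ; comm = ⊛-comm
      }
    ; distribʳ = ⊛-distribʳ
    ; zeroˡ = ⊛-zeroˡ
    }
  }
  where
  module + where
    open import Algebra.Structures {A = Series} _≈_ using (IsCommutativeMonoid)
    isCommutativeMonoid : IsCommutativeMonoid _⊕_ 𝟘
    isCommutativeMonoid = Pointwise.isCommutativeMonoid ℕ ℤ.+-0-isCommutativeMonoid
    open IsCommutativeMonoid isCommutativeMonoid public using (isEquivalence)

module S = CommutativeSemiring seriesSemiring
import Relation.Binary.Reasoning.Setoid S.setoid as ≈-Reasoning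

-- Multiplication by monomials.

-- The constant term of `x^ suc m` is zero and its tail is `x^ m`, so each power of x lowers the
-- index by one.
x^-⊛-+ : ∀ m f k → (x^ m ⊛ f) (m + k) ≡ f k
x^-⊛-+ zero    f k = ⊛-identityˡ f k
x^-⊛-+ (suc m) f k = trans (ℤ.+-identityˡ _) (x^-⊛-+ m f k)

x^-⊛-< : ∀ m f {k} → k ℕ.< m → (x^ m ⊛ f) k ≡ 0ℤ
x^-⊛-< (suc m) f {zero}  _         = refl
x^-⊛-< (suc m) f {suc k} (s≤s k<m) = trans (ℤ.+-identityˡ _) (x^-⊛-< m f k<m)

x^-+ : ∀ m n → x^ m ⊛ x^ n ≈ x^ (m + n)
x^-+ zero    n         = ⊛-identityˡ (x^ n)
x^-+ (suc m) n zero    = refl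
x^-+ (suc m) n (suc k) = trans (ℤ.+-identityˡ _) (x^-+ m n k)

⊛-distribˡ-⊖ : ∀ f g h → f ⊛ (g ⊖ h) ⊕ f ⊛ h ≈ f ⊛ g
⊛-distribˡ-⊖ f g h = begin
  f ⊛ (g ⊖ h) ⊕ f ⊛ h ≈⟨ S.distribˡ f (g ⊖ h) h ⟨
  f ⊛ (g ⊖ h ⊕ h)     ≈⟨ S.*-congˡ {f} (λ k → solve 2 (λ a b → (a :- b) :+ b := a) refl (g k) (h k)) ⟩
  f ⊛ g               ∎
  where
  open ≈-Reasoning
  open +-*-Solver

-- The term x^m cancels in (x^m - x^(m+n)) + (1 - x^m).
x^-telescope : ∀ m n → x^ m ⊛ (𝟙 ⊖ x^ n) ⊕ (𝟙 ⊖ x^ m) ≈ 𝟙 ⊖ x^ (m + n)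
x^-telescope m n k = begin
  p ℤ.+ (𝟙 k ℤ.- (x^ m) k)
    ≡⟨ cong (λ t → p ℤ.+ (𝟙 k ℤ.- t)) x^m≡ ⟨
  p ℤ.+ (𝟙 k ℤ.- (p ℤ.+ (x^ (m + n)) k))
    ≡⟨ solve 3 (λ p a b → p :+ (a :- (p :+ b)) := a :- b) refl p (𝟙 k) ((x^ (m + n)) k) ⟩
  𝟙 k ℤ.- (x^ (m + n)) k ∎
  where
  open ≡-Reasoning
  open +-*-Solver
  p = (x^ m ⊛ (𝟙 ⊖ x^ n)) k
  x^m≡ : p ℤ.+ (x^ (m + n)) k ≡ (x^ m) k
  x^m≡ = begin
    p ℤ.+ (x^ (m + n)) k    ≡⟨ cong (λ t → p ℤ.+ t) (x^-+ m n k) ⟨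
    p ℤ.+ (x^ m ⊛ x^ n) k   ≡⟨ ⊛-distribˡ-⊖ (x^ m) 𝟙 (x^ n) k ⟩
    (x^ m ⊛ 𝟙) k            ≡⟨ S.*-identityʳ (x^ m) k ⟩
    (x^ m) k                ∎

-- The Gaussian coefficient as a fraction, and its q-Pascal rule.

open ≈-Reasoning

-- ∏_{j < d} (1 - x^(n - j)); the factor with j = n makes this vanish for d > n.
numerator : ℕ → ℕ → Series
numerator n       zero    = 𝟙
numerator zero    (suc d) = 𝟘
numerator (suc n) (suc d) = (𝟙 ⊖ x^ suc n) ⊛ numerator n d

1/denominator : ℕ → Series
1/denominator zero    = 𝟙
1/denominator (suc d) = 1/denominator d ⊛ 1/1-x^ suc d

-- The definition splits off the factor of largest exponent, this lemma the one of smallest. For d ≥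
-- n the truncated `n ∸ d` is 0, and the factor 1 - x^0 = 0 agrees with the vanishing left side.
numerator-sucʳ : ∀ n d → numerator n (suc d) ≈ numerator n d ⊛ (𝟙 ⊖ x^ (n ∸ d))
numerator-sucʳ zero    zero    = S.sym (S.trans (⊛-identityˡ (𝟙 ⊖ x^ 0)) λ k → ℤ.+-inverseʳ (𝟙 k))
numerator-sucʳ zero    (suc d) = S.sym (⊛-zeroˡ (𝟙 ⊖ x^ 0))
numerator-sucʳ (suc n) zero    = ⊛-comm (𝟙 ⊖ x^ suc n) 𝟙
numerator-sucʳ (suc n) (suc d) = begin
  (𝟙 ⊖ x^ suc n) ⊛ numerator n (suc d)
    ≈⟨ S.*-congˡ {𝟙 ⊖ x^ suc n} (numerator-sucʳ n d) ⟩
  (𝟙 ⊖ x^ suc n) ⊛ (numerator n d ⊛ (𝟙 ⊖ x^ (n ∸ d)))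
    ≈⟨ ⊛-assoc (𝟙 ⊖ x^ suc n) (numerator n d) (𝟙 ⊖ x^ (n ∸ d)) ⟨
  (𝟙 ⊖ x^ suc n) ⊛ numerator n d ⊛ (𝟙 ⊖ x^ (n ∸ d)) ∎

numerator-vanishes : ∀ {n d} → n ℕ.< d → numerator n d ≈ 𝟘
numerator-vanishes {zero}  (s≤s z≤n) = S.refl
numerator-vanishes {suc n} {suc d} (s≤s n<d) = begin
  (𝟙 ⊖ x^ suc n) ⊛ numerator n d ≈⟨ S.*-congˡ {𝟙 ⊖ x^ suc n} (numerator-vanishes n<d) ⟩
  (𝟙 ⊖ x^ suc n) ⊛ 𝟘             ≈⟨ S.zeroʳ (𝟙 ⊖ x^ suc n) ⟩
  𝟘                              ∎

-- After the common factor `numerator n d` is taken out, `x^-telescope` remains: x^(n-d) (1 -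
-- x^(d+1)) + (1 - x^(n-d)) = 1 - x^(n+1).
numerator-pascal : ∀ n d →
  x^ (n ∸ d) ⊛ (numerator n d ⊛ (𝟙 ⊖ x^ suc d)) ⊕ numerator n (suc d) ≈ numerator (suc n) (suc d)
numerator-pascal n d = begin
  x ⊛ (r ⊛ v) ⊕ numerator n (suc d) ≈⟨ S.+-congˡ {x ⊛ (r ⊛ v)} (numerator-sucʳ n d) ⟩
  x ⊛ (r ⊛ v) ⊕ r ⊛ (𝟙 ⊖ x)         ≈⟨ solve 4 (λ x r v u → x :* (r :* v) :+ r :* u := (x :* v :+ u) :* r)
                                              S.refl x r v (𝟙 ⊖ x) ⟩
  (x ⊛ v ⊕ (𝟙 ⊖ x)) ⊛ r             ≈⟨ S.*-congʳ {r} (x^-telescope (n ∸ d) (suc d)) ⟩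
  (𝟙 ⊖ x^ (n ∸ d + suc d)) ⊛ r      ≈⟨ last-step ⟩
  (𝟙 ⊖ x^ suc n) ⊛ r                ∎
  where
  open SemiringSolver seriesSemiring
  x = x^ (n ∸ d)
  r = numerator n d
  v = 𝟙 ⊖ x^ suc d
  last-step : (𝟙 ⊖ x^ (n ∸ d + suc d)) ⊛ r ≈ (𝟙 ⊖ x^ suc n) ⊛ r
  -- The exponents agree only for d ≤ n; otherwise `r` vanishes.
  last-step with d ℕ.≤? n
  ... | yes d≤n = S.reflexive (cong (λ e → (𝟙 ⊖ x^ e) ⊛ r)
                    (trans (ℕ.+-suc (n ∸ d) d) (cong suc (ℕ.m∸n+n≡m d≤n))))
  ... | no d≰n = begin
    (𝟙 ⊖ x^ (n ∸ d + suc d)) ⊛ r ≈⟨ S.*-congˡ {𝟙 ⊖ x^ (n ∸ d + suc d)} r≈𝟘 ⟩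
    (𝟙 ⊖ x^ (n ∸ d + suc d)) ⊛ 𝟘 ≈⟨ S.zeroʳ (𝟙 ⊖ x^ (n ∸ d + suc d)) ⟩
    𝟘                            ≈⟨ S.zeroʳ (𝟙 ⊖ x^ suc n) ⟨
    (𝟙 ⊖ x^ suc n) ⊛ 𝟘           ≈⟨ S.*-congˡ {𝟙 ⊖ x^ suc n} r≈𝟘 ⟨
    (𝟙 ⊖ x^ suc n) ⊛ r           ∎
    where
    r≈𝟘 = numerator-vanishes (ℕ.≰⇒> d≰n)

-- Inserting 1 = (1 - x^(d+1)) / (1 - x^(d+1)) brings the first term to the denominator of `suc d`;
-- then `numerator-pascal` applies.
fraction-pascal : ∀ n d →
  x^ (n ∸ d) ⊛ (numerator n d ⊛ 1/denominator d) ⊕ numerator n (suc d) ⊛ 1/denominator (suc d)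
    ≈ numerator (suc n) (suc d) ⊛ 1/denominator (suc d)
fraction-pascal n d = begin
  x ⊛ (r ⊛ e) ⊕ s ⊛ (e ⊛ g)
    ≈⟨ S.+-congʳ {s ⊛ (e ⊛ g)} (S.*-congˡ {x} (S.*-congˡ {r} (S.*-identityʳ e))) ⟨
  x ⊛ (r ⊛ (e ⊛ 𝟙)) ⊕ s ⊛ (e ⊛ g)
    ≈⟨ S.+-congʳ {s ⊛ (e ⊛ g)} (S.*-congˡ {x} (S.*-congˡ {r} (S.*-congˡ {e} (1-x^i-inverse (suc d))))) ⟨
  x ⊛ (r ⊛ (e ⊛ (v ⊛ g))) ⊕ s ⊛ (e ⊛ g)
    ≈⟨ solve 6 (λ x r e v g s → x :* (r :* (e :* (v :* g))) :+ s :* (e :* g)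
                 := (x :* (r :* v) :+ s) :* (e :* g)) S.refl x r e v g s ⟩
  (x ⊛ (r ⊛ v) ⊕ s) ⊛ (e ⊛ g)
    ≈⟨ S.*-congʳ {e ⊛ g} (numerator-pascal n d) ⟩
  numerator (suc n) (suc d) ⊛ (e ⊛ g) ∎
  where
  open SemiringSolver seriesSemiring
  x = x^ (n ∸ d)
  r = numerator n d
  e = 1/denominator d
  v = 𝟙 ⊖ x^ suc d
  g = 1/1-x^ suc d
  s = numerator n (suc d)

Π-∷ʳ : ∀ fs g → Π (fs ∷ʳ g) ≈ Π fs ⊛ g
Π-∷ʳ []       g = ⊛-comm g 𝟙
Π-∷ʳ (f ∷ fs) g = begin
  f ⊛ Π (fs ∷ʳ g) ≈⟨ S.*-congˡ {f} (Π-∷ʳ fs g) ⟩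
  f ⊛ (Π fs ⊛ g)  ≈⟨ ⊛-assoc f (Π fs) g ⟨
  f ⊛ Π fs ⊛ g    ∎

-- With c - d held fixed as `m`, the factors do not depend on d, so passing to `suc d` appends a
-- single factor.
Π-fraction : ∀ m d →
  Π (applyUpTo (λ i → (𝟙 ⊖ x^ (m + suc i)) ⊛ (1/1-x^ suc i)) d) ≈ numerator (m + d) d ⊛ 1/denominator d
Π-fraction m zero    = S.sym (⊛-identityˡ 𝟙)
Π-fraction m (suc d) = begin
  Π (applyUpTo F (suc d))
    ≡⟨ cong Π (applyUpTo-∷ʳ F d) ⟨
  Π (applyUpTo F d ∷ʳ F d)
    ≈⟨ Π-∷ʳ (applyUpTo F d) (F d) ⟩
  Π (applyUpTo F d) ⊛ F d
    ≈⟨ S.*-congʳ {F d} (Π-fraction m d) ⟩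
  numerator (m + d) d ⊛ 1/denominator d ⊛ F d
    ≈⟨ solve 4 (λ r e u g → r :* e :* (u :* g) := u :* r :* (e :* g)) S.refl
         (numerator (m + d) d) (1/denominator d) (𝟙 ⊖ x^ (m + suc d)) (1/1-x^ suc d) ⟩
  (𝟙 ⊖ x^ (m + suc d)) ⊛ numerator (m + d) d ⊛ 1/denominator (suc d)
    ≡⟨ cong (λ c → (𝟙 ⊖ x^ c) ⊛ numerator (m + d) d ⊛ 1/denominator (suc d)) (ℕ.+-suc m d) ⟩
  numerator (suc (m + d)) (suc d) ⊛ 1/denominator (suc d)
    ≡⟨ cong (λ c → numerator c (suc d) ⊛ 1/denominator (suc d)) (ℕ.+-suc m d) ⟨
  numerator (m + suc d) (suc d) ⊛ 1/denominator (suc d) ∎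
  where
  open SemiringSolver seriesSemiring
  F : ℕ → Series
  F i = (𝟙 ⊖ x^ (m + suc i)) ⊛ (1/1-x^ suc i)

gaussian-fraction : ∀ {n d} → d ℕ.≤ n → gaussian n d ≈ numerator n d ⊛ 1/denominator d
gaussian-fraction {n} {d} d≤n = S.trans (Π-fraction (n ∸ d) d)
  (S.reflexive (cong (λ c → numerator c d ⊛ 1/denominator d) (ℕ.m∸n+n≡m d≤n)))

-- Counting with filtered lists.

module _ {A B : Set} {P : Pred B 0ℓ} {Q : Pred A 0ℓ} (P? : Decidable P) (Q? : Decidable Q) where

  length-filter-map : (f : A → B) → P ∘ f ≐ Q →
    ∀ xs → length (filter P? (map f xs)) ≡ length (filter Q? xs)
  length-filter-map f P∘f≐Q xs = trans (go xs) (cong length (filter-≐ (P? ∘ f) Q? P∘f≐Q xs))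
    where
    go : ∀ xs → length (filter P? (map f xs)) ≡ length (filter (P? ∘ f) xs)
    go []       = refl
    go (x ∷ xs) with does (P? (f x))
    ... | false = go xs
    ... | true  = cong suc (go xs)

length-filter-++ : ∀ {A : Set} {P : Pred A 0ℓ} (P? : Decidable P) xs ys →
  length (filter P? (xs ++ ys)) ≡ length (filter P? xs) + length (filter P? ys)
length-filter-++ P? xs ys =
  trans (cong length (filter-++ P? xs ys)) (length-++ (filter P? xs))

-- Occurrences of 𝚊𝚋 after a letter is prepended.

AB : ∀ {n} → Word n → Pred (Fin n × Fin n) 0ℓ
AB w (i , j) = i Fin.< j × lookup w i ≡ 𝚊 × lookup w j ≡ 𝚋

ab? : ∀ {n} (w : Word n) → Decidable (AB w)
ab? w (i , j) = i Fin.<? j ×-dec lookup w i ≟ᴸ 𝚊 ×-dec lookup w j ≟ᴸ 𝚋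

allFin-suc : ∀ n → allFin (suc n) ≡ Fin.zero ∷ map Fin.suc (allFin n)
allFin-suc n = cong (Fin.zero ∷_) (sym (map-tabulate id Fin.suc))

ab-lower-row : ∀ {n} x (w : Word n) i js →
  length (filter (ab? (x ∷ w)) (map (Fin.suc i ,_) (map Fin.suc js))) ≡
  length (filter (ab? w) (map (i ,_) js))
ab-lower-row x w i js =
  trans (length-filter-map (ab? (x ∷ w)) (λ j → ab? (x ∷ w) (Fin.suc i , j)) (Fin.suc i ,_)
           (id , id) (map Fin.suc js))
  (trans (length-filter-map (λ j → ab? (x ∷ w) (Fin.suc i , j)) (λ j → ab? w (i , j)) Fin.suc
            (map₁ s<s⁻¹ , map₁ s<s) js)
  (sym (length-filter-map (ab? w) (λ j → ab? w (i , j)) (i ,_) (id , id) js)))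

-- The pairs `(Fin.suc i , Fin.zero)` drop out by computation, as no position precedes the first.
ab-lower-rows : ∀ {n} x (w : Word n) is js →
  length (filter (ab? (x ∷ w)) (cartesianProduct (map Fin.suc is) (Fin.zero ∷ map Fin.suc js))) ≡
  length (filter (ab? w) (cartesianProduct is js))
ab-lower-rows x w []       js = refl
ab-lower-rows x w (i ∷ is) js = trans
  (length-filter-++ (ab? (x ∷ w)) (map (Fin.suc i ,_) (map Fin.suc js)) _)
  (trans (cong₂ _+_ (ab-lower-row x w i js) (ab-lower-rows x w is js))
         (sym (length-filter-++ (ab? w) (map (i ,_) js) _)))

-- Pairs are split by whether their first position is the new letter; those where it is not are the
-- pairs of `w` with both positions raised.
#ab-∷ : ∀ {n} x (w : Word n) →
  #ab (x ∷ w) ≡ length (filter (ab? (x ∷ w)) (map (Fin.zero ,_) (map Fin.suc (allFin n)))) + #ab w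
#ab-∷ {n} x w = trans
  (cong (λ is → length (filter (ab? (x ∷ w)) (cartesianProduct is is))) (allFin-suc n))
  (trans (length-filter-++ (ab? (x ∷ w)) (map (Fin.zero ,_) (map Fin.suc (allFin n))) _)
         (cong (length (filter (ab? (x ∷ w)) (map (Fin.zero ,_) (map Fin.suc (allFin n)))) +_)
               (ab-lower-rows x w (allFin n) (allFin n))))

#𝚋 : ∀ {n} (w : Word n) → length (filter (λ j → lookup w j ≟ᴸ 𝚋) (allFin n)) ≡ n ∸ ∣ w ∣ₐ
#𝚋 []                = refl
-- The tail of `allFin (suc n)` is abstracted so that matching on `refl` turns it into
-- `map Fin.suc (allFin n)`.
#𝚋 {suc n} (x ∷ w) with tabulate {n = n} Fin.suc | map-tabulate {n = n} id Fin.suc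
#𝚋 {suc n} (𝚊 ∷ w) | _ | refl = trans
  (length-filter-map (λ j → lookup (𝚊 ∷ w) j ≟ᴸ 𝚋) (λ j → lookup w j ≟ᴸ 𝚋) Fin.suc
      (id , id) (allFin n))
  (#𝚋 w)
#𝚋 {suc n} (𝚋 ∷ w) | _ | refl = trans
  (cong suc (trans
    (length-filter-map (λ j → lookup (𝚋 ∷ w) j ≟ᴸ 𝚋) (λ j → lookup w j ≟ᴸ 𝚋) Fin.suc
        (id , id) (allFin n))
    (#𝚋 w)))
  -- The subtraction is truncated, so moving `suc` inside it uses `∣ w ∣ₐ` ≤ n.
  (sym (ℕ.+-∸-assoc 1 (count≤n (𝚊 ≟ᴸ_) w)))

#ab-𝚋∷ : ∀ {n} (w : Word n) → #ab (𝚋 ∷ w) ≡ #ab w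
#ab-𝚋∷ {n} w = trans (#ab-∷ 𝚋 w) (cong (_+ #ab w)
  (trans (length-filter-map (ab? (𝚋 ∷ w)) (λ j → ab? (𝚋 ∷ w) (Fin.zero , j)) (Fin.zero ,_)
            (id , id) (map Fin.suc (allFin n)))
         (cong length (filter-none (λ j → ab? (𝚋 ∷ w) (Fin.zero , j))
                        (universal (λ { _ (_ , () , _) }) (map Fin.suc (allFin n)))))))

-- The new 𝚊 pairs with every 𝚋 of `w`, and `#𝚋` counts these.
#ab-𝚊∷ : ∀ {n d} (w : Word n) → d ≡ ∣ w ∣ₐ → #ab (𝚊 ∷ w) ≡ n ∸ d + #ab w
#ab-𝚊∷ {n} w refl = trans (#ab-∷ 𝚊 w) (cong (_+ #ab w)
  (trans (length-filter-map (ab? (𝚊 ∷ w)) (λ j → ab? (𝚊 ∷ w) (Fin.zero , j)) (Fin.zero ,_)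
            (id , id) (map Fin.suc (allFin n)))
  (trans (length-filter-map (λ j → ab? (𝚊 ∷ w) (Fin.zero , j)) (λ j → lookup w j ≟ᴸ 𝚋) Fin.suc
            ((λ (_ , _ , p) → p) , λ p → s≤s z≤n , refl , p) (allFin n))
         (#𝚋 w))))

-- Words with prescribed numbers of 𝚊 and 𝚊𝚋.

-- The equations are oriented as in `_∼₂_`, so that `class w` is definitionally the fiber at
-- `∣ w ∣ₐ` and `#ab w`.
inFiber? : ∀ {n} d k → Decidable (λ (w : Word n) → d ≡ ∣ w ∣ₐ × k ≡ #ab w)
inFiber? d k w = d ℕ.≟ ∣ w ∣ₐ ×-dec k ℕ.≟ #ab w

fiberSize : ℕ → ℕ → ℕ → ℕ
fiberSize n d k = length (filter (inFiber? d k) (words n))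

-- The generating function by `#ab` of the words of length n with d letters 𝚊.
fiberSeries : ℕ → ℕ → Series
fiberSeries n d k = ℤ.+ fiberSize n d k

fiberSize-suc : ∀ n d k → fiberSize (suc n) d k ≡
  length (filter (λ w → inFiber? d k (𝚊 ∷ w)) (words n)) + fiberSize n d k
fiberSize-suc n d k = trans
  (length-filter-++ (inFiber? d k) (map (𝚊 ∷_) (words n)) _)
  (cong₂ _+_
    (length-filter-map (inFiber? d k) (λ w → inFiber? d k (𝚊 ∷ w)) (𝚊 ∷_) (id , id) (words n))
    -- `words (suc n)` ends with an appended empty list, removed here.
    (trans (cong (length ∘ filter (inFiber? d k)) (++-identityʳ (map (𝚋 ∷_) (words n))))
           (length-filter-map (inFiber? d k) (inFiber? d k) (𝚋 ∷_)
             ((λ {w} → map₂ (λ e → trans e (#ab-𝚋∷ w))) , λ {w} → map₂ (λ e → trans e (sym (#ab-𝚋∷ w))))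
             (words n))))

-- A leading 𝚊 adds n - d occurrences, which shifts the coefficients by that amount; below the shift
-- the fiber is empty.
fiber-𝚊 : ∀ n d → (λ k → ℤ.+ length (filter (λ w → inFiber? (suc d) k (𝚊 ∷ w)) (words n)))
                  ≈ x^ (n ∸ d) ⊛ fiberSeries n d
fiber-𝚊 n d k with n ∸ d ℕ.≤? k
... | yes n∸d≤k with ℕ.m≤n⇒∃[o]m+o≡n n∸d≤k
...   | j , refl = trans (cong (ℤ.+_ ∘ length) shift) (sym (x^-⊛-+ (n ∸ d) (fiberSeries n d) j))
  where
  shift : filter (λ w → inFiber? (suc d) (n ∸ d + j) (𝚊 ∷ w)) (words n) ≡ filter (inFiber? d j) (words n)
  shift = filter-≐ (λ w → inFiber? (suc d) (n ∸ d + j) (𝚊 ∷ w)) (inFiber? d j)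
    ( (λ {w} (p , q) → ℕ.suc-injective p ,
        ℕ.+-cancelˡ-≡ (n ∸ d) _ _ (trans q (#ab-𝚊∷ w (ℕ.suc-injective p))))
    , λ {w} (p , q) → cong suc p , trans (cong (n ∸ d +_) q) (sym (#ab-𝚊∷ w p))
    ) (words n)
fiber-𝚊 n d k | no n∸d≰k = trans
  (cong (ℤ.+_ ∘ length) (filter-none (λ w → inFiber? (suc d) k (𝚊 ∷ w))
    (universal ∉fiber (words n))))
  (sym (x^-⊛-< (n ∸ d) (fiberSeries n d) (ℕ.≰⇒> n∸d≰k)))
  where
  ∉fiber : ∀ w → ¬ (suc d ≡ ∣ 𝚊 ∷ w ∣ₐ × k ≡ #ab (𝚊 ∷ w))
  ∉fiber w (p , q) = n∸d≰k (subst (n ∸ d ℕ.≤_)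
    (sym (trans q (#ab-𝚊∷ w (ℕ.suc-injective p)))) (ℕ.m≤m+n (n ∸ d) (#ab w)))

-- Induction on n, as both sides obey the same recursion. It covers d > n too, where both sides
-- vanish: the recursion at d = n already refers to `fiberSeries n (suc n)`.
fiberSeries-fraction : ∀ n d → fiberSeries n d ≈ numerator n d ⊛ 1/denominator d
fiberSeries-fraction zero    zero    k = trans (base k) (sym (⊛-identityˡ 𝟙 k))
  where
  base : fiberSeries 0 0 ≈ 𝟙
  base zero    = refl
  base (suc k) = refl
fiberSeries-fraction zero    (suc d) k = sym (⊛-zeroˡ (1/denominator (suc d)) k)
fiberSeries-fraction (suc n) zero    k = trans
  (cong ℤ.+_ (trans (fiberSize-suc n 0 k) (cong (λ ws → length ws + fiberSize n 0 k)
    (filter-none (λ w → inFiber? 0 k (𝚊 ∷ w)) (universal (λ { _ (() , _) }) (words n))))))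
  -- `numerator n 0` is 𝟙 for every n, so the induction hypothesis fits unchanged.
  (fiberSeries-fraction n zero k)
fiberSeries-fraction (suc n) (suc d) = begin
  fiberSeries (suc n) (suc d)
    ≈⟨ (λ k → trans (cong ℤ.+_ (fiberSize-suc n (suc d) k))
                    (cong (ℤ._+ fiberSeries n (suc d) k) (fiber-𝚊 n d k))) ⟩
  x^ (n ∸ d) ⊛ fiberSeries n d ⊕ fiberSeries n (suc d)
    ≈⟨ S.+-cong (S.*-congˡ {x^ (n ∸ d)} (fiberSeries-fraction n d)) (fiberSeries-fraction n (suc d)) ⟩
  x^ (n ∸ d) ⊛ (numerator n d ⊛ 1/denominator d) ⊕ numerator n (suc d) ⊛ 1/denominator (suc d)
    ≈⟨ fraction-pascal n d ⟩
  numerator (suc n) (suc d) ⊛ 1/denominator (suc d) ∎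

-- Class sizes and the distribution polynomial.

exponent≡length-class : ∀ {n} (w : Word n) → exponent w ≡ ℤ.+ length (class w)
exponent≡length-class {n} w =
  trans (gaussian-fraction (count≤n (𝚊 ≟ᴸ_) w) (#ab w))
        (sym (fiberSeries-fraction n ∣ w ∣ₐ (#ab w)))

exponent-cong : ∀ {n} (u w : Word n) → u ∼₂ w → exponent u ≡ exponent w
exponent-cong {n} u w (p , q) = cong₂ (gaussian n) p q

-- An entry of the quotient is `class w` for some `w`; any `u` in it is equivalent to `w` and so has
-- the same exponent.
length≡exponent : ∀ {n} {X : List (Word n)} {u} → X ∈ quotient n → u ∈ X →
  length X ≡ ∣ exponent u ∣
length≡exponent {n} {u = u} X∈ u∈X
  with ∈-map⁻ class (∈-deduplicate⁻ (≡-dec _≟ᵂ_) (map class (words n)) X∈)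
... | w , _ , refl with ∈-filter⁻ (w ∼₂?_) {xs = words n} u∈X
...   | _ , w∼u = cong ∣_∣ (sym (trans (sym (exponent-cong w u w∼u)) (exponent≡length-class w)))

-- Agreement is asked only on entries of the list, since `rep X ∈ X` is known only for X in the
-- quotient.
Σ-cong : ∀ {A : Set} {f g : A → Series} xs → (∀ x → x ∈ xs → f x ≈ g x) → Σ[ xs ] f ≈ Σ[ xs ] g
Σ-cong []       f≈g k = refl
Σ-cong (x ∷ xs) f≈g k =
  cong₂ ℤ._+_ (f≈g x (here refl) k) (Σ-cong xs (λ y y∈xs → f≈g y (there y∈xs)) k)

corollary6 : (n : ℕ) →
    (∀ (w : Word n) → 0ℤ ≤ exponent w) ×
    (∀ (u w : Word n) → u ∼₂ w → exponent u ≡ exponent w) ×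
    (∀ (rep : List (Word n) → Word n) →
    (∀ X → X ∈ quotient n → rep X ∈ X) →
    sizePolynomial n ≈ (Σ[ quotient n ] λ X → x^ ∣ exponent (rep X) ∣))
corollary6 n =
    -- The exponent is a class size, hence nonnegative, so `∣_∣` in the theorem does not change its
    -- value.
    (λ w → subst (0ℤ ≤_) (sym (exponent≡length-class w)) (ℤ.+≤+ z≤n))
  , exponent-cong
  , λ rep rep∈ → Σ-cong (quotient n) λ X X∈ k →
      cong (λ m → (x^ m) k) (length≡exponent X∈ (rep∈ X X∈))
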